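{- Let $G$ be a connected graph and let $v\in V(G)$ be a cut-vertex such that $G-v$ has exactly two connected components $G_1$ and $G_2$. If $G[V(G_i)\cup\{v\}]$ is isomorphic to a path for $i=1$ or for $i=2$, then $v$ is not a basis forced vertex of $G$.
   Context: All graphs are finite and simple. For vertices $u,v$ of a connected graph $G$, $d(u,v)$ is the length of a shortest $u$–$v$ path. A set $R\subseteq V(G)$ is a resolving set if for all distinct $x,y\in V(G)$ there is $r\in R$ with $d(r,x)\neq d(r,y)$. The metric dimension $\dim(G)$ is the minimum cardinality of a resolving set, and a resolving set of cardinality $\dim(G)$ is a metric basis. A vertex is a basis forced vertex if it belongs to every metric basis of $G$. A cut-vertex is a vertex $v$ such that $G-v$ is disconnected; $G[S]$ denotes the subgraph induced by $S$. -}

module Defs where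

open import Data.Nat.Base using (ℕ; zero; suc; _≤_)
import Data.Nat.Properties as ℕ
open import Data.Fin.Base using (Fin; toℕ)
open import Data.Fin.Subset using (Subset; _∈_; _⊆_; ∁; ⁅_⁆; ∣_∣; Nonempty)
open import Data.List.Base using (List; []; _∷_)
open import Data.List.Relation.Unary.Unique.Propositional using (Unique)
open import Data.Product.Base using (Σ; ∃; ∃₂; _×_; proj₁)
open import Data.Sum.Base using (_⊎_; inj₁; inj₂; swap)
open import Function.Bundles using (_↔_; _⇔_; Inverse)
open import Level using (0ℓ)
open import Relation.Binary.Core using (Rel)
open import Relation.Binary.Definitions using (Decidable; Symmetric)
open import Relation.Binary.PropositionalEquality using (_≡_; _≢_)
open import Relation.Nullary using (¬_)
open import Relation.Nullary.Decidable using (_⊎-dec_)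

-- A simple graph on the vertex type V.  Finite graphs are those with V = Fin n;
-- other vertex types only arise as those of induced subgraphs of finite graphs.
record Graph (V : Set) : Set₁ where
  field
    Adj        : Rel V 0ℓ
    adj?       : Decidable Adj
    adj-sym    : Symmetric Adj
    adj-irrefl : ∀ {u} → ¬ Adj u u

open Graph public

module _ {V : Set} (G : Graph V) where

  infixr 5 _∷_

  data Walk : V → V → Set where
    [_] : ∀ u → Walk u u
    _∷_ : ∀ {u v w} → Adj G u v → Walk v w → Walk u w

  length : ∀ {u w} → Walk u w → ℕ
  length [ _ ]   = zero
  length (_ ∷ p) = suc (length p)

  vertices : ∀ {u w} → Walk u w → List V
  vertices [ u ]       = u ∷ []
  vertices {u} (_ ∷ p) = u ∷ vertices p

  Path : V → V → Set
  Path u w = Σ (Walk u w) λ p → Unique (vertices p)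

  -- The graph without vertices counts as connected here.
  Connected : Set
  Connected = ∀ u w → Path u w

  -- IsDistance u w k  means  d(u,w) = k.
  IsDistance : V → V → ℕ → Set
  IsDistance u w k = (∃ λ (p : Path u w) → length (proj₁ p) ≡ k)
                   × (∀ (p : Path u w) → k ≤ length (proj₁ p))

  -- d(r,x) ≠ d(r,y), both distances being defined.
  Distinguishes : V → V → V → Set
  Distinguishes r x y = ∃₂ λ k l → IsDistance r x k × IsDistance r y l × k ≢ l

module _ {n : ℕ} (G : Graph (Fin n)) where

  IsResolving : Subset n → Set
  IsResolving R = ∀ x y → x ≢ y → ∃ λ r → r ∈ R × Distinguishes G r x y

  -- IsMetricDimension k  means  dim(G) = k.
  IsMetricDimension : ℕ → Set
  IsMetricDimension k = (∃ λ R → IsResolving R × ∣ R ∣ ≡ k)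
                      × (∀ R → IsResolving R → k ≤ ∣ R ∣)

  IsMetricBasis : Subset n → Set
  IsMetricBasis R = IsResolving R × IsMetricDimension ∣ R ∣

  BasisForced : Fin n → Set
  BasisForced v = ∀ R → IsMetricBasis R → v ∈ R

  -- G[S].  Membership proofs x ∈ S are unique, so the vertices of G[S] are
  -- exactly the elements of S.
  Induced : (S : Subset n) → Graph (Σ (Fin n) (_∈ S))
  Induced S = record
    { Adj        = λ x y → Adj G (proj₁ x) (proj₁ y)
    ; adj?       = λ x y → adj? G (proj₁ x) (proj₁ y)
    ; adj-sym    = adj-sym G
    ; adj-irrefl = adj-irrefl G
    }

  -- V(G - v); the graph G - v itself is Induced (Without v).
  Without : Fin n → Subset n
  Without v = ∁ ⁅ v ⁆

  IsCutVertex : Fin n → Set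
  IsCutVertex v = ¬ Connected (Induced (Without v))

  -- C is the vertex set of a connected component of G[S], i.e. of a maximal
  -- (nonempty) connected subgraph.
  record IsComponent (S C : Subset n) : Set where
    field
      contained : C ⊆ S
      nonempty  : Nonempty C
      connected : Connected (Induced C)
      maximal   : ∀ D → C ⊆ D → D ⊆ S → Connected (Induced D) → D ≡ C

  -- The connected components of G[S] are exactly G[C₁] and G[C₂], and these
  -- are different.
  record HasExactlyTwoComponents (S C₁ C₂ : Subset n) : Set where
    field
      component₁ : IsComponent S C₁
      component₂ : IsComponent S C₂
      distinct   : C₁ ≢ C₂
      noOther    : ∀ C → IsComponent S C → C ≡ C₁ ⊎ C ≡ C₂

record _≅_ {V W : Set} (G : Graph V) (H : Graph W) : Set where
  field
    bijection : V ↔ W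
    adjacency : ∀ x y → Adj G x y ⇔ Adj H (Inverse.to bijection x) (Inverse.to bijection y)

-- The path on the m vertices 0, 1, …, m - 1.
PathGraph : (m : ℕ) → Graph (Fin m)
PathGraph m = record
  { Adj        = λ i j → suc (toℕ i) ≡ toℕ j ⊎ suc (toℕ j) ≡ toℕ i
  ; adj?       = λ i j → (suc (toℕ i) ℕ.≟ toℕ j) ⊎-dec (suc (toℕ j) ℕ.≟ toℕ i)
  ; adj-sym    = swap
  ; adj-irrefl = λ { (inj₁ e) → ℕ.1+n≢n e ; (inj₂ e) → ℕ.1+n≢n e }
  }

IsomorphicToPath : {V : Set} → Graph V → Set
IsomorphicToPath G = ∃ λ m → G ≅ PathGraph m

{-# OPTIONS --safe #-}
module Submission where

-- Let C be the component with G[C ∪ {v}] a path.  Since C is connected, v is an end of that path;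
-- let u be the other end.  Off C we have d(u,x) = d(u,v) + d(v,x), while on C the values d(u,x)
-- are pairwise distinct and smaller than d(u,v).  Hence u distinguishes every pair that v does,
-- and replacing v by u in a metric basis gives a metric basis without v.

open import Defs
open import Data.Empty using (⊥)
open import Data.Fin.Base using (Fin; zero; suc; toℕ; fromℕ; inject₁; opposite)
open import Data.Fin.Induction using (<-weakInduction)
open import Data.Fin.Properties using (_≟_; any?; toℕ-injective; toℕ-fromℕ; toℕ-inject₁; toℕ<n; toℕ≤pred[n]; opposite-prop; opposite-involutive)
open import Data.Fin.Subset using (Subset; inside; outside; ⊤; ∁; _∈_; _∉_; _∪_; _∩_; _⊆_; ⁅_⁆; ∣_∣)
open import Data.Fin.Subset.Properties using (_∈?_; ∈⊤; x∈⁅x⁆; x∈⁅y⁆⇒x≡y; x≢y⇒x∉⁅y⁆; x∉p⇒x∈∁p; x∈∁p⇒x∉p; x∈p∩q⁺; x∈p∩q⁻; p∩q⊆p; x∈p∪q⁻; p⊆p∪q; q⊆p∪q; ∪-identityʳ; p⊂q⇒∣p∣<∣q∣)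
import Data.List.Membership.DecPropositional as DecMembership
open import Data.List.Membership.Propositional using () renaming (_∈_ to _∈ₗ_)
open import Data.List.Relation.Unary.All using ([])
open import Data.List.Relation.Unary.All.Properties using (¬Any⇒All¬)
open import Data.List.Relation.Unary.AllPairs using ([]; _∷_)
open import Data.List.Relation.Unary.Any using (here; there)
open import Data.List.Relation.Unary.Unique.Propositional using (Unique)
open import Data.Nat.Base using (ℕ; zero; suc; _+_; _≤_; _<_; z≤n; s≤s)
open import Data.Nat.Induction using (<-rec)
import Data.Nat.Properties as ℕ
open import Data.Product.Base using (∃; _×_; _,_; proj₁; proj₂)
open import Data.Product.Properties using (≡-dec)
open import Data.Sum.Base using (_⊎_; inj₁; inj₂; [_,_]′)
open import Data.Vec.Base using (_∷_)
open import Data.Vec.Properties.WithK using ([]=-irrelevant)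
open import Function.Base using (_∘_)
open import Function.Bundles using (mk⇔; mk↔ₛ′; Equivalence; Inverse)
open import Function.Construct.Composition using (_↔-∘_)
open import Relation.Binary.Definitions using (DecidableEquality)
open import Relation.Binary.PropositionalEquality using (_≡_; _≢_; refl; sym; trans; cong; subst; subst₂)
open import Relation.Nullary using (¬_; Dec; yes; no; contradiction)
open import Relation.Nullary.Decidable using (map′; _×-dec_)
open import Relation.Unary using (Decidable)

-- Least witnesses and sizes of subsets.

least : ∀ {P : ℕ → Set} → Decidable P → ∀ k → P k → ∃ λ j → P j × (∀ i → P i → j ≤ i)
least {P} P? = <-rec _ step
  where
  step : ∀ k → (∀ {i} → i < k → P i → ∃ λ j → P j × (∀ i → P i → j ≤ i)) →
         P k → ∃ λ j → P j × (∀ i → P i → j ≤ i)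
  step k rec Pk with ℕ.anyUpTo? P? k
  ... | yes (i , i<k , Pi) = rec i<k Pi
  ... | no  none           = k , Pk , λ i Pi → ℕ.≮⇒≥ λ i<k → none (i , i<k , Pi)

∣p∪⁅x⁆∣≤1+∣p∣ : ∀ {n} (p : Subset n) x → ∣ p ∪ ⁅ x ⁆ ∣ ≤ suc ∣ p ∣
∣p∪⁅x⁆∣≤1+∣p∣ (inside  ∷ p) zero    rewrite ∪-identityʳ p = s≤s (ℕ.n≤1+n _)
∣p∪⁅x⁆∣≤1+∣p∣ (outside ∷ p) zero    rewrite ∪-identityʳ p = ℕ.≤-refl
∣p∪⁅x⁆∣≤1+∣p∣ (inside  ∷ p) (suc x) = s≤s (∣p∪⁅x⁆∣≤1+∣p∣ p x)
∣p∪⁅x⁆∣≤1+∣p∣ (outside ∷ p) (suc x) = ∣p∪⁅x⁆∣≤1+∣p∣ p x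

∣p∩∁⁅x⁆∣<∣p∣ : ∀ {n} (p : Subset n) {x} → x ∈ p → ∣ p ∩ ∁ ⁅ x ⁆ ∣ < ∣ p ∣
∣p∩∁⁅x⁆∣<∣p∣ p {x} x∈p = p⊂q⇒∣p∣<∣q∣
  (p∩q⊆p p _ , x , x∈p , λ x∈ → x∈∁p⇒x∉p (proj₂ (x∈p∩q⁻ p _ x∈)) (x∈⁅x⁆ x))

-- Walks, and distances measured by walks.

module _ {V : Set} (G : Graph V) where

  infixr 5 _++_

  _++_ : ∀ {u v w} → Walk G u v → Walk G v w → Walk G u w
  [ _ ]   ++ q = q
  (e ∷ p) ++ q = e ∷ (p ++ q)

  length-++ : ∀ {u v w} (p : Walk G u v) (q : Walk G v w) →
              length G (p ++ q) ≡ length G p + length G q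
  length-++ [ _ ]   q = refl
  length-++ (e ∷ p) q = cong suc (length-++ p q)

  reverse : ∀ {u w} → Walk G u w → Walk G w u
  reverse [ u ]   = [ u ]
  reverse (e ∷ p) = reverse p ++ (adj-sym G e ∷ [ _ ])

  -- Walks, unlike paths, can be concatenated without checking that vertices stay distinct;
  -- `shorten` makes the two notions of distance agree.
  IsWalkDistance : V → V → ℕ → Set
  IsWalkDistance u w k = (∃ λ (p : Walk G u w) → length G p ≡ k)
                       × (∀ (p : Walk G u w) → k ≤ length G p)

  -- A potential that grows by at most one per edge bounds walk lengths from below; applied to
  -- `pos`, it rules out shortcuts.
  lipschitz-length : (f : V → ℕ) → (∀ {x y} → Adj G x y → f y ≤ suc (f x)) →
                     ∀ {u w} (p : Walk G u w) → f w ≤ f u + length G p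
  lipschitz-length f lip [ u ] = ℕ.m≤m+n _ 0
  lipschitz-length f lip {u} {w} (_∷_ {v = x} e p) = begin
    f w                     ≤⟨ lipschitz-length f lip p ⟩
    f x + length G p        ≤⟨ ℕ.+-monoˡ-≤ _ (lip e) ⟩
    suc (f u) + length G p  ≡⟨ ℕ.+-suc (f u) _ ⟨
    f u + suc (length G p)  ∎
    where open ℕ.≤-Reasoning

  suffixPath : ∀ {u v w} (p : Walk G v w) → Unique (vertices G p) → u ∈ₗ vertices G p →
               ∃ λ (q : Path G u w) → length G (proj₁ q) ≤ length G p
  suffixPath [ _ ]   uniq       (here refl) = ([ _ ] , uniq) , z≤n
  suffixPath (e ∷ p) uniq       (here refl) = (e ∷ p , uniq) , ℕ.≤-refl
  suffixPath (e ∷ p) (_ ∷ uniq) (there u∈p) =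
    let q , q≤p = suffixPath p uniq u∈p in q , ℕ.m≤n⇒m≤1+n q≤p

  module _ (_≟V_ : DecidableEquality V) where
    open DecMembership _≟V_ using () renaming (_∈?_ to _∈ₗ?_)

    -- The tail is made a path first; if the head already lies on it, only the part from that
    -- occurrence on is kept.
    shorten : ∀ {u w} (p : Walk G u w) → ∃ λ (q : Path G u w) → length G (proj₁ q) ≤ length G p
    shorten [ u ] = ([ u ] , [] ∷ []) , z≤n
    shorten {u} (e ∷ p) with shorten p
    ... | (q , uniq) , q≤p with u ∈ₗ? vertices G q
    ...   | yes u∈q = let r , r≤q = suffixPath q uniq u∈q in
                      r , ℕ.≤-trans r≤q (ℕ.m≤n⇒m≤1+n q≤p)
    ...   | no  u∉q = (e ∷ q , ¬Any⇒All¬ _ u∉q ∷ uniq) , s≤s q≤p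

    walkDistance⇒distance : ∀ {u w k} → IsWalkDistance u w k → IsDistance G u w k
    walkDistance⇒distance ((p , refl) , min) =
      let q , q≤p = shorten p in (q , ℕ.≤-antisym q≤p (min (proj₁ q))) , min ∘ proj₁

    distance⇒walkDistance : ∀ {u w k} → IsDistance G u w k → IsWalkDistance u w k
    distance⇒walkDistance ((p , eq) , min) =
      (proj₁ p , eq) , λ q → let r , r≤q = shorten q in ℕ.≤-trans (min r) r≤q

-- Existence of distances, and exchange in resolving sets.

module _ {n : ℕ} (G : Graph (Fin n)) where

  -- A finite search over first steps; with it `least` turns the path given by connectedness into a
  -- distance.
  walkOfLength? : ∀ k u w → Dec (∃ λ (p : Walk G u w) → length G p ≡ k)
  walkOfLength? zero u w = map′ (λ { refl → [ u ] , refl }) (λ { ([ _ ] , _) → refl }) (u ≟ w)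
  walkOfLength? (suc k) u w = map′
    (λ { (_ , e , p , eq) → e ∷ p , cong suc eq })
    (λ { (e ∷ p , eq) → _ , e , p , ℕ.suc-injective eq })
    (any? λ x → adj? G u x ×-dec walkOfLength? k x w)

  distance : Connected G → ∀ u w → ∃ (IsDistance G u w)
  distance conn u w =
    let k , walk , min = least (λ k → walkOfLength? k u w) _ (proj₁ (conn u w) , refl)
    in k , walkDistance⇒distance G _≟_ (walk , λ p → min _ (p , refl))

  ⊤-resolving : Connected G → IsResolving G ⊤
  ⊤-resolving conn x y x≢y with distance conn x y
  ... | zero  , (([ _ ] , _) , _) , _ = contradiction refl x≢y
  -- The vertex `x` itself resolves the pair, being at distance 0 from itself only.
  ... | suc l , d = x , ∈⊤ , 0 , suc l ,
                    ((([ x ] , [] ∷ []) , refl) , λ _ → z≤n) , d , λ ()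

  -- No decision procedure for minimality is needed: if a smaller resolving set existed,
  -- the induction hypothesis would already refute it.
  replaceable⇒¬forced : Connected G → ∀ v →
    (∀ R → IsResolving G R → v ∈ R → ∃ λ R′ → IsResolving G R′ × ∣ R′ ∣ ≤ ∣ R ∣ × v ∉ R′) →
    ¬ BasisForced G v
  replaceable⇒¬forced conn v replace forced = <-rec Impossible step _ ⊤ (⊤-resolving conn) refl
    where
    Impossible : ℕ → Set
    Impossible k = ∀ R → IsResolving G R → ∣ R ∣ ≡ k → ⊥

    step : ∀ k → (∀ {i} → i < k → Impossible i) → Impossible k
    step _ rec R res refl =
      -- Under the induction hypothesis `R` is a basis, so it contains `v`. Its replacement `R′` is
      -- no larger, hence a basis too, although it avoids `v`.
      let R′ , res′ , R′≤R , v∉R′ = replace R res (forced R (res , (R , res , refl) , minimal))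
      in v∉R′ (forced R′ (res′ , (R′ , res′ , refl) , λ S → ℕ.≤-trans R′≤R ∘ minimal S))
      where
      minimal : ∀ S → IsResolving G S → ∣ R ∣ ≤ ∣ S ∣
      minimal S resS = ℕ.≮⇒≥ λ S<R → rec S<R S resS refl

  -- Exchange: deleting `v` frees one place for `u`, which takes over the pairs assigned to `v`;
  -- every other pair keeps its resolver.
  dominated⇒replaceable : ∀ {u v} → u ≢ v →
    (∀ {x y} → x ≢ y → Distinguishes G v x y → Distinguishes G u x y) →
    ∀ R → IsResolving G R → v ∈ R → ∃ λ R′ → IsResolving G R′ × ∣ R′ ∣ ≤ ∣ R ∣ × v ∉ R′
  dominated⇒replaceable {u} {v} u≢v dom R res v∈R = R′ , res′ , size , v∉R′
    where
    R′ : Subset n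
    R′ = (R ∩ ∁ ⁅ v ⁆) ∪ ⁅ u ⁆

    res′ : IsResolving G R′
    res′ x y x≢y with res x y x≢y
    ... | r , r∈R , dist with r ≟ v
    ...   | yes refl = u , q⊆p∪q _ _ (x∈⁅x⁆ u) , dom x≢y dist
    ...   | no  r≢v  = r , p⊆p∪q _ (x∈p∩q⁺ (r∈R , x∉p⇒x∈∁p (x≢y⇒x∉⁅y⁆ r≢v))) , dist

    size : ∣ R′ ∣ ≤ ∣ R ∣
    size = ℕ.≤-trans (∣p∪⁅x⁆∣≤1+∣p∣ (R ∩ ∁ ⁅ v ⁆) u) (∣p∩∁⁅x⁆∣<∣p∣ R v∈R)

    v∉R′ : v ∉ R′
    v∉R′ v∈ with x∈p∪q⁻ (R ∩ ∁ ⁅ v ⁆) ⁅ u ⁆ v∈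
    ... | inj₁ v∈R-v = x∈∁p⇒x∉p (proj₂ (x∈p∩q⁻ R _ v∈R-v)) (x∈⁅x⁆ v)
    ... | inj₂ v∈⁅u⁆ = u≢v (sym (x∈⁅y⁆⇒x≡y u v∈⁅u⁆))

  -- Components of induced subgraphs.

  liftWalk : ∀ {S T : Subset n} {a b} → S ⊆ T → Walk (Induced G S) a b →
             ∀ a∈T b∈T → Walk (Induced G T) (proj₁ a , a∈T) (proj₁ b , b∈T)
  liftWalk S⊆T [ a , _ ] a∈T b∈T rewrite []=-irrelevant a∈T b∈T = [ a , b∈T ]
  liftWalk S⊆T (_∷_ {v = x , x∈S} e p) a∈T b∈T = e ∷ liftWalk S⊆T p (S⊆T x∈S) b∈T

  -- Adding `y` to `C` keeps it connected through the edge to `x`, so by maximality `y` was already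
  -- there.
  component-closed : ∀ {S C x y} → IsComponent G S C → x ∈ C → Adj G x y → y ∈ S → y ∈ C
  component-closed {S} {C} {x} {y} comp x∈C e y∈S =
    subst (y ∈_) (maximal D C⊆D D⊆S D-connected) y∈D
    where
    open IsComponent comp

    D : Subset n
    D = C ∪ ⁅ y ⁆

    C⊆D : C ⊆ D
    C⊆D = p⊆p∪q _

    y∈D : y ∈ D
    y∈D = q⊆p∪q _ _ (x∈⁅x⁆ y)

    D⊆S : D ⊆ S
    D⊆S z∈D with x∈p∪q⁻ C ⁅ y ⁆ z∈D
    ... | inj₁ z∈C   = contained z∈C
    ... | inj₂ z∈⁅y⁆ rewrite x∈⁅y⁆⇒x≡y y z∈⁅y⁆ = y∈S

    -- `x` serves as a hub: any two vertices of `D` are joined by a walk through it.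
    toX : ∀ a → Walk (Induced G D) a (x , C⊆D x∈C)
    toX (a , a∈D) with x∈p∪q⁻ C ⁅ y ⁆ a∈D
    ... | inj₁ a∈C   = liftWalk C⊆D (proj₁ (connected (a , a∈C) (x , x∈C))) a∈D _
    ... | inj₂ a∈⁅y⁆ with refl ← x∈⁅y⁆⇒x≡y y a∈⁅y⁆ = adj-sym G e ∷ [ _ ]

    D-connected : Connected (Induced G D)
    D-connected a b = proj₁ (shorten (Induced G D) (≡-dec _≟_ (λ p q → yes ([]=-irrelevant p q)))
      (_++_ (Induced G D) (toX a) (reverse (Induced G D) (toX b))))

-- Reversal of a path graph.

opposite-adj : ∀ {m} {i j : Fin m} → Adj (PathGraph m) i j →
               Adj (PathGraph m) (opposite i) (opposite j)
opposite-adj {m} = [ inj₂ ∘ flip , inj₁ ∘ flip ]′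
  where
  flip : ∀ {i j : Fin m} → suc (toℕ i) ≡ toℕ j → suc (toℕ (opposite j)) ≡ toℕ (opposite i)
  flip {i} {j} eq rewrite opposite-prop i | opposite-prop j | eq = sym (ℕ.+-∸-assoc 1 (toℕ<n j))

-- Lets `v` be taken as the last vertex of the path whenever it is an end.
flipPath : ∀ {V} {G : Graph V} {m} → G ≅ PathGraph m → G ≅ PathGraph m
flipPath {m = m} φ = record
  { bijection = mk↔ₛ′ opposite opposite opposite-involutive opposite-involutive ↔-∘ bijection
  ; adjacency = λ x y → mk⇔
      (opposite-adj ∘ Equivalence.to (adjacency x y))
      (λ a → Equivalence.from (adjacency x y)
               (subst₂ (Adj (PathGraph m)) (opposite-involutive _) (opposite-involutive _)
                       (opposite-adj a)))
  }
  where open _≅_ φ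

pathAdj⇒≤ : ∀ {m} {i j : Fin m} → Adj (PathGraph m) i j → toℕ j ≤ suc (toℕ i)
pathAdj⇒≤ (inj₁ eq) = ℕ.≤-reflexive (sym eq)
pathAdj⇒≤ (inj₂ eq) = ℕ.≤-trans (ℕ.n≤1+n _) (ℕ.m≤n⇒m≤1+n (ℕ.≤-reflexive eq))

-- A component that forms a path together with the cut-vertex.

module _ {n : ℕ} (G : Graph (Fin n)) (v : Fin n) (C : Subset n)
         (comp : IsComponent G (Without G v) C) where

  open IsComponent comp

  private
    P : Subset n
    P = C ∪ ⁅ v ⁆

    C⊆P : C ⊆ P
    C⊆P = p⊆p∪q _

    v∈P : v ∈ P
    v∈P = q⊆p∪q _ _ (x∈⁅x⁆ v)

    ∈C⇒≢v : ∀ {x} → x ∈ C → x ≢ v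
    ∈C⇒≢v x∈C refl = x∈∁p⇒x∉p (contained x∈C) (x∈⁅x⁆ v)

    ∈P∧≢v⇒∈C : ∀ {x} → x ∈ P → x ≢ v → x ∈ C
    ∈P∧≢v⇒∈C x∈P x≢v with x∈p∪q⁻ C ⁅ v ⁆ x∈P
    ... | inj₁ x∈C   = x∈C
    ... | inj₂ x∈⁅v⁆ = contradiction (x∈⁅y⁆⇒x≡y v x∈⁅v⁆) x≢v

    ∈P∧∉C⇒≡v : ∀ {x} → x ∈ P → x ∉ C → x ≡ v
    ∈P∧∉C⇒≡v x∈P x∉C with x∈p∪q⁻ C ⁅ v ⁆ x∈P
    ... | inj₁ x∈C   = contradiction x∈C x∉C
    ... | inj₂ x∈⁅v⁆ = x∈⁅y⁆⇒x≡y v x∈⁅v⁆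

    -- The only exit from `C` is `v`: any other neighbour lies in `G - v` and thus in the same
    -- component.
    neighbour : ∀ {x y} → x ∈ C → Adj G x y → y ∈ P
    neighbour {y = y} x∈C e with y ≟ v
    ... | yes refl = v∈P
    ... | no  y≢v  = C⊆P (component-closed G comp x∈C e (x∉p⇒x∈∁p (x≢y⇒x∉⁅y⁆ y≢v)))

  module Labelled {M : ℕ} (φ : Induced G P ≅ PathGraph (suc M)) where
    open _≅_ φ using (bijection; adjacency)
    open Inverse bijection using (strictlyInverseˡ; strictlyInverseʳ) renaming (to to label; from to vertex)

    label-injective : ∀ {x y} → label x ≡ label y → x ≡ y
    label-injective {x} {y} eq =
      trans (sym (strictlyInverseʳ x)) (trans (cong vertex eq) (strictlyInverseʳ y))

    labelℕ : ∀ {x} → x ∈ P → ℕ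
    labelℕ x∈P = toℕ (label (_ , x∈P))

    labelℕ-injective : ∀ {x y} (x∈P : x ∈ P) (y∈P : y ∈ P) → labelℕ x∈P ≡ labelℕ y∈P → x ≡ y
    labelℕ-injective _ _ = cong proj₁ ∘ label-injective ∘ toℕ-injective

    labelℕ-vertex : ∀ i → labelℕ (proj₂ (vertex i)) ≡ toℕ i
    labelℕ-vertex i = cong toℕ (strictlyInverseˡ i)

    vertex∈C : ∀ i → i ≢ label (v , v∈P) → proj₁ (vertex i) ∈ C
    vertex∈C i i≢v with v ≟ proj₁ (vertex i)
    ... | no  v≢ = ∈P∧≢v⇒∈C (proj₂ (vertex i)) (v≢ ∘ sym)
    ... | yes v≡ = contradiction (toℕ-injective (trans (sym (labelℕ-vertex i)) (same _ v≡))) i≢v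
      where
      same : ∀ {x} (x∈P : x ∈ P) → v ≡ x → labelℕ x∈P ≡ labelℕ v∈P
      same x∈P refl = cong labelℕ ([]=-irrelevant x∈P v∈P)

    -- Labels change by at most one along an edge, so a walk inside C cannot jump over v.
    stays-below : ∀ {a b} → Walk (Induced G C) a b → ∀ (a∈P : proj₁ a ∈ P) (b∈P : proj₁ b ∈ P) →
                  labelℕ a∈P < labelℕ v∈P → labelℕ b∈P < labelℕ v∈P
    stays-below [ _ ] a∈P b∈P rewrite []=-irrelevant a∈P b∈P = λ lt → lt
    stays-below (_∷_ {v = x , x∈C} e p) a∈P b∈P a<v = stays-below p (C⊆P x∈C) b∈P
      (ℕ.≤∧≢⇒< (ℕ.≤-trans (pathAdj⇒≤ (Equivalence.to (adjacency _ _) e)) a<v)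
               (∈C⇒≢v x∈C ∘ labelℕ-injective _ _))

    -- Otherwise the vertices labelled 0 and `M` lie in `C` on different sides of `v`, and a walk
    -- inside `C` joins them, against `stays-below`.
    v-is-end : label (v , v∈P) ≡ zero ⊎ label (v , v∈P) ≡ fromℕ M
    v-is-end with label (v , v∈P) ≟ zero | label (v , v∈P) ≟ fromℕ M
    ... | yes eq | _      = inj₁ eq
    ... | no _   | yes eq = inj₂ eq
    ... | no v≢0 | no v≢M = contradiction M<v (ℕ.≤⇒≯ (toℕ≤pred[n] (label (v , v∈P))))
      where
      first<v : labelℕ (proj₂ (vertex zero)) < labelℕ v∈P
      first<v rewrite labelℕ-vertex zero = ℕ.n≢0⇒n>0 (v≢0 ∘ toℕ-injective)

      M<v : M < labelℕ v∈P
      M<v = subst (_< labelℕ v∈P) (trans (labelℕ-vertex (fromℕ M)) (toℕ-fromℕ M))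
        (stays-below (proj₁ (connected (_ , vertex∈C zero (v≢0 ∘ sym))
                                       (_ , vertex∈C (fromℕ M) (v≢M ∘ sym))))
                     _ _ first<v)

    -- Distances from the far end of the path.

    module _ (v-last : label (v , v∈P) ≡ fromℕ M) where

      u : Fin n
      u = proj₁ (vertex zero)

      labelℕ-v : labelℕ v∈P ≡ M
      labelℕ-v = trans (cong toℕ v-last) (toℕ-fromℕ M)

      -- The label along the path, frozen at the label `M` of `v` everywhere else. This makes it
      -- constant off `C` and Lipschitz on all of `G`.
      pos : Fin n → ℕ
      pos x with x ∈? P
      ... | yes x∈P = labelℕ x∈P
      ... | no  _   = M

      pos-P : ∀ {x} (x∈P : x ∈ P) → pos x ≡ labelℕ x∈P
      pos-P {x} x∈P with x ∈? P
      ... | yes x∈P′ = cong labelℕ ([]=-irrelevant x∈P′ x∈P)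
      ... | no  x∉P  = contradiction x∈P x∉P

      pos-v : pos v ≡ M
      pos-v = trans (pos-P v∈P) labelℕ-v

      pos-u : pos u ≡ 0
      pos-u = trans (pos-P (proj₂ (vertex zero))) (labelℕ-vertex zero)

      pos≤M : ∀ x → pos x ≤ M
      pos≤M x with x ∈? P
      ... | yes x∈P = toℕ≤pred[n] (label (x , x∈P))
      ... | no  _   = ℕ.≤-refl

      pos-injective : ∀ {x y} → x ∈ P → y ∈ P → pos x ≡ pos y → x ≡ y
      pos-injective x∈P y∈P eq =
        labelℕ-injective x∈P y∈P (trans (sym (pos-P x∈P)) (trans eq (pos-P y∈P)))

      pos-C : ∀ {x} → x ∈ C → pos x < M
      pos-C {x} x∈C = ℕ.≤∧≢⇒< (pos≤M x)
        λ eq → ∈C⇒≢v x∈C (pos-injective (C⊆P x∈C) v∈P (trans eq (sym pos-v)))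

      pos-∉C : ∀ {x} → x ∉ C → pos x ≡ M
      pos-∉C {x} x∉C with x ∈? P
      ... | no  _   = refl
      ... | yes x∈P with refl ← ∈P∧∉C⇒≡v x∈P x∉C =
        trans (cong labelℕ ([]=-irrelevant x∈P v∈P)) labelℕ-v

      -- Off `C` the value is already the maximum `M`; from inside `C` an edge stays in `P`, where
      -- adjacent labels differ by one.
      pos-lipschitz : ∀ {x y} → Adj G x y → pos y ≤ suc (pos x)
      pos-lipschitz {x} {y} e with x ∈? C
      ... | no x∉C = ℕ.m≤n⇒m≤1+n (subst (pos y ≤_) (sym (pos-∉C x∉C)) (pos≤M y))
      ... | yes x∈C rewrite pos-P (C⊆P x∈C) | pos-P (neighbour x∈C e) =
        pathAdj⇒≤ (Equivalence.to (adjacency _ _) e)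

      pos≤length : ∀ {x} (p : Walk G u x) → pos x ≤ length G p
      pos≤length {x} p = subst (λ k → pos x ≤ k + length G p) pos-u
        (lipschitz-length G pos pos-lipschitz p)

      walkTo : ∀ i → ∃ λ (p : Walk G u (proj₁ (vertex i))) → length G p ≡ toℕ i
      walkTo = <-weakInduction _ ([ u ] , refl) extend
        where
        extend : ∀ i → (∃ λ (p : Walk G u (proj₁ (vertex (inject₁ i)))) → length G p ≡ toℕ (inject₁ i)) →
                 ∃ λ (p : Walk G u (proj₁ (vertex (suc i)))) → length G p ≡ suc (toℕ i)
        extend i (p , eq) = _++_ G p (e ∷ [ _ ]) ,
          trans (length-++ G p _) (trans (ℕ.+-comm _ 1) (cong suc (trans eq (toℕ-inject₁ i))))
          where
          e : Adj G (proj₁ (vertex (inject₁ i))) (proj₁ (vertex (suc i)))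
          e = Equivalence.from (adjacency _ _) (inj₁ (trans (cong suc
                (trans (labelℕ-vertex (inject₁ i)) (toℕ-inject₁ i))) (sym (labelℕ-vertex (suc i)))))

      walkInP : ∀ {x} → x ∈ P → ∃ λ (p : Walk G u x) → length G p ≡ pos x
      walkInP {x} x∈P = subst (λ z → ∃ λ (p : Walk G u z) → length G p ≡ pos x)
        (cong proj₁ (strictlyInverseʳ (x , x∈P)))
        (let p , eq = walkTo (label (x , x∈P)) in p , trans eq (sym (pos-P x∈P)))

      -- The walk along the labels attains `pos`, and the Lipschitz bound shows that no walk in `G`
      -- is shorter.
      distance-P : ∀ {x} → x ∈ P → IsDistance G u x (pos x)
      distance-P x∈P = walkDistance⇒distance G _≟_ (walkInP x∈P , pos≤length)

      -- The walk is followed to its first visit to `v`, and `q` is the remainder. `pos` must climb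
      -- from `pos w` to `M` on the way, by at most one per edge.
      leaves-through-v : ∀ {w x} → w ∈ P → x ∉ C → (p : Walk G w x) →
                         ∃ λ (q : Walk G v x) → M + length G q ≤ pos w + length G p
      leaves-through-v {w} w∈P x∉C p with w ∈? C
      leaves-through-v w∈P x∉C p | no w∉C with refl ← ∈P∧∉C⇒≡v w∈P w∉C =
        p , ℕ.≤-reflexive (cong (_+ length G p) (sym pos-v))
      leaves-through-v w∈P x∉C [ _ ] | yes w∈C = contradiction w∈C x∉C
      leaves-through-v {w} w∈P x∉C (_∷_ {v = y} e p) | yes w∈C =
        let q , le = leaves-through-v (neighbour w∈C e) x∉C p in q , (begin
          M + length G q            ≤⟨ le ⟩
          pos y + length G p        ≤⟨ ℕ.+-monoˡ-≤ _ (pos-lipschitz e) ⟩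
          suc (pos w) + length G p  ≡⟨ ℕ.+-suc (pos w) _ ⟨
          pos w + suc (length G p)  ∎)
        where open ℕ.≤-Reasoning

      -- Every walk from `u` to `x` passes through `v`, and `M` is the distance from `u` to `v`.
      distance-∉C : ∀ {x k} → x ∉ C → IsDistance G v x k → IsDistance G u x (M + k)
      distance-∉C {x} {k} x∉C d with distance⇒walkDistance G _≟_ d
      ... | (q , refl) , min = walkDistance⇒distance G _≟_ (walk , bound)
        where
        walk : ∃ λ (p : Walk G u x) → length G p ≡ M + length G q
        walk = let p , eq = walkInP v∈P in
          _++_ G p q , trans (length-++ G p q) (cong (_+ length G q) (trans eq pos-v))

        bound : ∀ p → M + length G q ≤ length G p
        bound p = let r , le = leaves-through-v (proj₂ (vertex zero)) x∉C p in
          ℕ.≤-trans (ℕ.+-monoʳ-≤ M (min r)) (subst (λ j → M + length G r ≤ j + length G p) pos-u le)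

      u-dominates-v : ∀ {x y} → x ≢ y → Distinguishes G v x y → Distinguishes G u x y
      u-dominates-v {x} {y} x≢y (k , l , dk , dl , k≢l) with x ∈? C | y ∈? C
      ... | yes x∈C | yes y∈C = _ , _ , distance-P (C⊆P x∈C) , distance-P (C⊆P y∈C) ,
                                x≢y ∘ pos-injective (C⊆P x∈C) (C⊆P y∈C)
      -- `M` is a threshold: distances from `u` are below it on `C` and at least `M` off `C`.
      ... | yes x∈C | no  y∉C = _ , _ , distance-P (C⊆P x∈C) , distance-∉C y∉C dl ,
                                ℕ.<⇒≢ (ℕ.<-≤-trans (pos-C x∈C) (ℕ.m≤m+n M l))
      ... | no  x∉C | yes y∈C = _ , _ , distance-∉C x∉C dk , distance-P (C⊆P y∈C) ,
                                ℕ.>⇒≢ (ℕ.<-≤-trans (pos-C y∈C) (ℕ.m≤m+n M k))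
      ... | no  x∉C | no  y∉C = _ , _ , distance-∉C x∉C dk , distance-∉C y∉C dl ,
                                k≢l ∘ ℕ.+-cancelˡ-≡ M k l

      u≢v : u ≢ v
      -- A vertex of the nonempty `C` has `pos` below `M`, so `M` is positive, whereas `u ≡ v` would
      -- give `M ≡ 0`.
      u≢v u≡v = ℕ.n≮0 (subst (pos (proj₁ nonempty) <_) M≡0 (pos-C (proj₂ nonempty)))
        where
        M≡0 : M ≡ 0
        M≡0 = trans (sym pos-v) (trans (cong pos (sym u≡v)) pos-u)

      ¬forced-if-last : Connected G → ¬ BasisForced G v
      ¬forced-if-last conn =
        replaceable⇒¬forced G conn v (dominated⇒replaceable G u≢v u-dominates-v)

  pathComponent⇒¬forced : Connected G → IsomorphicToPath (Induced G P) → ¬ BasisForced G v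
  pathComponent⇒¬forced conn (zero  , φ) with () ← Inverse.to (_≅_.bijection φ) (v , v∈P)
  pathComponent⇒¬forced conn (suc M , φ) with Labelled.v-is-end φ
  ... | inj₂ v-last  = Labelled.¬forced-if-last φ v-last conn
  -- Reversal sends label 0 to the last label, which reduces this case to the previous one.
  ... | inj₁ v-first = Labelled.¬forced-if-last (flipPath φ) (cong opposite v-first) conn

theorem2 : ∀ (n : ℕ) (G : Graph (Fin n)) → Connected G →
    ∀ (v : Fin n) → IsCutVertex G v →
    ∀ (C₁ C₂ : Subset n) → HasExactlyTwoComponents G (Without G v) C₁ C₂ →
    IsomorphicToPath (Induced G (C₁ ∪ ⁅ v ⁆)) ⊎ IsomorphicToPath (Induced G (C₂ ∪ ⁅ v ⁆)) →
    ¬ BasisForced G v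
theorem2 n G conn v _ C₁ C₂ two =
  [ pathComponent⇒¬forced G v C₁ component₁ conn , pathComponent⇒¬forced G v C₂ component₂ conn ]′
  where open HasExactlyTwoComponents two
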